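{- For every integer $n\ge 1$, $$\mathrm{pf}_n(213,321)=C_n+\sum_{m=1}^{n-1}m\,h_{n,m},$$ where $C_n=\frac{1}{n+1}\binom{2n}{n}$ is the $n$th Catalan number and $h_{n,m}$ is the number of Dyck paths of semilength $n$ in which the $m$th north step is immediately followed by an east step.
   Context: A Dyck path of semilength $n$ is a lattice path from $(0,0)$ to $(n,n)$ consisting of $n$ north steps $N=(0,1)$ and $n$ east steps $E=(1,0)$ that never goes below the line $y=x$. A parking function of size $n$ is a Dyck path of semilength $n$ whose $n$ north steps are labeled bijectively by $\{1,\dots,n\}$ so that whenever two north steps are consecutive in the path (one immediately following the other), the label of the later one is larger. For a parking function $p$ of size $n$, $\phi(p)$ is the permutation of $\{1,\dots,n\}$ (in one-line notation) obtained by reading the labels of the north steps in the order they occur along the path. A permutation $\pi$ of $\{1,\dots,n\}$ contains a permutation $\rho$ of $\{1,\dots,m\}$ if there are indices $1\le i_1<\cdots<i_m\le n$ such that $\pi_{i_a}\le\pi_{i_b}$ if and only if $\rho_a\le\rho_b$; otherwise $\pi$ avoids $\rho$. For permutations $\rho_1,\dots,\rho_r$, $\mathrm{pf}_n(\rho_1,\dots,\rho_r)$ denotes the number of parking functions $p$ of size $n$ such that $\phi(p)$ avoids each of $\rho_1,\dots,\rho_r$. North steps of a path are numbered $1,\dots,n$ in the order they occur along the path. -}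

module Defs where

open import Data.Fin.Base as Fin using (Fin; zero; suc; toℕ)
import Data.Fin.Properties as Fin
open import Data.List.Base using
  (List; []; _∷_; allFin; applyUpTo; cartesianProductWith; filter; inits; length; lookup; map)
open import Data.List.Relation.Unary.All using (All; all?)
open import Data.List.Relation.Unary.Linked using (Linked; linked?)
open import Data.Nat.Base using (ℕ; zero; suc; _+_; _*_; _∸_; _≤_)
open import Data.Nat.Combinatorics using (_C_)
open import Data.Nat.DivMod using (_/_)
open import Data.Nat.ListAction using (sum)
open import Data.Nat.Properties using (_≟_; _≤?_)
open import Data.Product.Base using (_×_; _,_; ∃; map₂; uncurry)
open import Data.Unit.Base using (⊤; tt)
open import Data.Vec.Base as Vec using (Vec; []; _∷_)
open import Function.Base using (_∘_)
open import Function.Bundles using (_⇔_; mk⇔; Equivalence)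
open import Function.Definitions using (Injective; Surjective; Bijective)
open import Level using (0ℓ)
open import Relation.Binary.PropositionalEquality.Core using (_≡_; refl)
open import Relation.Nullary.Decidable using
  (Dec; yes; no; map′; _×-dec_; _→-dec_; ¬?)
open import Relation.Nullary.Negation.Core using (¬_)
open import Relation.Unary using (Pred; Decidable)

------------------------------------------------------------------------
-- Counting

-- All words of a given length over an alphabet, each listed exactly once
-- when the alphabet has no repeated letters.
words : {A : Set} → List A → ℕ → List (List A)
words as zero    = [] ∷ []
words as (suc k) = cartesianProductWith _∷_ as (words as k)

count : {A : Set} {P : Pred A 0ℓ} → Decidable P → List A → ℕ
count P? = length ∘ filter P?

------------------------------------------------------------------------
-- Dyck paths

-- North steps carry a label in L; unlabelled paths are the case L = ⊤.
data Step (L : Set) : Set where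
  N : L → Step L
  E : Step L

module _ {L : Set} where

  labels : List (Step L) → List L
  labels []        = []
  labels (N a ∷ w) = a ∷ labels w
  labels (E ∷ w)   = labels w

  norths : List (Step L) → ℕ
  norths = length ∘ labels

  easts : List (Step L) → ℕ
  easts []        = 0
  easts (N _ ∷ w) = easts w
  easts (E ∷ w)   = suc (easts w)

  -- After the initial segment u the path is at (easts u , norths u).
  IsDyck : ℕ → List (Step L) → Set
  IsDyck n w =
    norths w ≡ n × easts w ≡ n × All (λ u → easts u ≤ norths u) (inits w)

  isDyck? : ∀ n → Decidable (IsDyck n)
  isDyck? n w =
    (norths w ≟ n) ×-dec (easts w ≟ n) ×-dec
    all? (λ u → easts u ≤? norths u) (inits w)

  -- The m-th north step, counted from 1, is immediately followed by an
  -- east step.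
  data NorthThenEast : ℕ → List (Step L) → Set where
    here  : ∀ {a w}   → NorthThenEast 1 (N a ∷ E ∷ w)
    north : ∀ {m a w} → NorthThenEast m w → NorthThenEast (suc m) (N a ∷ w)
    east  : ∀ {m w}   → NorthThenEast m w → NorthThenEast m (E ∷ w)

  ¬northThenEast-zero : ∀ w → ¬ NorthThenEast 0 w
  ¬northThenEast-zero (E ∷ w) (east p) = ¬northThenEast-zero w p

  northThenEast? : ∀ m → Decidable (NorthThenEast m)
  northThenEast? m             []            = no λ ()
  northThenEast? m             (E ∷ w)       =
    map′ east (λ { (east p) → p }) (northThenEast? m w)
  northThenEast? zero          (N a ∷ w)     = no λ ()
  northThenEast? (suc zero)    (N a ∷ [])    = no λ { (north ()) }
  northThenEast? (suc zero)    (N a ∷ E ∷ w) = yes here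
  northThenEast? (suc zero)    (N a ∷ N b ∷ w) =
    no λ { (north p) → ¬northThenEast-zero (N b ∷ w) p }
  northThenEast? (suc (suc m)) (N a ∷ w)     =
    map′ north (λ { (north p) → p }) (northThenEast? (suc m) w)

paths : ℕ → List (List (Step ⊤))
paths n = words (N tt ∷ E ∷ []) (n + n)

h : ℕ → ℕ → ℕ
h n m = count (λ w → isDyck? n w ×-dec northThenEast? m w) (paths n)

-- The division is exact.
catalan : ℕ → ℕ
catalan n = ((2 * n) C n) / suc n

∑[1≤m≤_]_ : ℕ → (ℕ → ℕ) → ℕ
∑[1≤m≤ k ] f = sum (map f (applyUpTo suc k))

------------------------------------------------------------------------
-- Permutations and patterns, in one-line notation

Contains : List ℕ → List ℕ → Set
Contains π ρ = ∃ λ (i : Vec (Fin (length π)) (length ρ)) →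
  (∀ a b → a Fin.< b → Vec.lookup i a Fin.< Vec.lookup i b) ×
  (∀ a b → (lookup π (Vec.lookup i a) ≤ lookup π (Vec.lookup i b))
             ⇔ (lookup ρ a ≤ lookup ρ b))

Avoids : List ℕ → List ℕ → Set
Avoids π ρ = ¬ Contains π ρ

∃Vec? : ∀ {n} m {P : Pred (Vec (Fin n) m) 0ℓ} → Decidable P → Dec (∃ P)
∃Vec? zero    P? = map′ ([] ,_) (λ { ([] , p) → p }) (P? [])
∃Vec? (suc m) P? =
  map′ (λ { (x , xs , p) → x ∷ xs , p }) (λ { (x ∷ xs , p) → x , xs , p })
       (Fin.any? λ x → ∃Vec? m λ xs → P? (x ∷ xs))

_⇔-dec_ : {A B : Set} → Dec A → Dec B → Dec (A ⇔ B)
a? ⇔-dec b? =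
  map′ (uncurry mk⇔) (λ e → Equivalence.to e , Equivalence.from e)
       ((a? →-dec b?) ×-dec (b? →-dec a?))

contains? : ∀ π ρ → Dec (Contains π ρ)
contains? π ρ = ∃Vec? (length ρ) λ i →
  (Fin.all? λ a → Fin.all? λ b →
    (a Fin.<? b) →-dec (Vec.lookup i a Fin.<? Vec.lookup i b)) ×-dec
  (Fin.all? λ a → Fin.all? λ b →
    (lookup π (Vec.lookup i a) ≤? lookup π (Vec.lookup i b))
      ⇔-dec (lookup ρ a ≤? lookup ρ b))

avoids? : ∀ π ρ → Dec (Avoids π ρ)
avoids? π ρ = ¬? (contains? π ρ)

bijective? : ∀ {m n} (f : Fin m → Fin n) → Dec (Bijective _≡_ _≡_ f)
bijective? f = injective? ×-dec surjective?
  where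
  injective? : Dec (Injective _≡_ _≡_ f)
  injective? =
    map′ (λ inj {x} {y} → inj x y) (λ inj x y → inj)
         (Fin.all? λ x → Fin.all? λ y → (f x Fin.≟ f y) →-dec (x Fin.≟ y))

  surjective? : Dec (Surjective _≡_ _≡_ f)
  surjective? =
    map′ (λ sur y → map₂ (λ { fx≡y refl → fx≡y }) (sur y))
         (λ sur y → map₂ (λ fz≡y → fz≡y refl) (sur y))
         (Fin.all? λ y → Fin.any? λ x → f x Fin.≟ y)

------------------------------------------------------------------------
-- Parking functions

-- The label k ∈ {1,…,n} is represented by k - 1 in Fin n.

Ascends : ∀ {n} → Step (Fin n) → Step (Fin n) → Set
Ascends (N a) (N b) = a Fin.< b
Ascends (N _) E     = ⊤
Ascends E     _     = ⊤

ascends? : ∀ {n} (s t : Step (Fin n)) → Dec (Ascends s t)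
ascends? (N a) (N b) = a Fin.<? b
ascends? (N _) E     = yes tt
ascends? E     _     = yes tt

IsParkingFunction : ∀ n → List (Step (Fin n)) → Set
IsParkingFunction n w =
  IsDyck n w × Bijective _≡_ _≡_ (lookup (labels w)) × Linked Ascends w

isParkingFunction? : ∀ n → Decidable (IsParkingFunction n)
isParkingFunction? n w =
  isDyck? n w ×-dec bijective? (lookup (labels w)) ×-dec linked? ascends? w

labelledPaths : ∀ n → List (List (Step (Fin n)))
labelledPaths n = words (E ∷ map N (allFin n)) (n + n)

φ : ∀ {n} → List (Step (Fin n)) → List ℕ
φ w = map (suc ∘ toℕ) (labels w)

pf : ℕ → List (List ℕ) → ℕ
pf n ρs =
  count (λ w → isParkingFunction? n w ×-dec all? (avoids? (φ w)) ρs)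
        (labelledPaths n)

{-# OPTIONS --safe #-}

-- A permutation avoiding 213 and 321 is either increasing or has exactly one
-- descent. In the latter case, if the descent is at position m, the values
-- after it form an interval: the permutation is
--   1 … i, i+b+1 … n, i+1 … i+b   with b = n - m and 0 ≤ i < m,
-- so there are m of them. The labels increase along consecutive north steps,
-- so a Dyck path admits the increasing permutation always, and one with
-- descent at m exactly when its m-th north step is followed by an east step.
-- Dyck paths are counted by the reflection principle.

module Submission where

open import Defs
open import Data.Bool.Base using (true; false)
open import Data.Fin.Base as Fin using (Fin; zero; suc; toℕ; fromℕ<)
import Data.Fin.Properties as Fin
open import Data.List.Base using
  (List; []; _∷_; _++_; applyUpTo; cartesianProduct; concat; filter; inits; length; lookup; map)
open import Data.List.Membership.Propositional using (_∈_)
open import Data.List.Membership.Propositional.Properties using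
  (∈-++⁺ˡ; ∈-++⁺ʳ; ∈-++⁻; ∈-allFin; ∈-applyUpTo⁺; ∈-applyUpTo⁻; ∈-cartesianProduct⁺;
   ∈-cartesianProduct⁻; ∈-cartesianProductWith⁺; ∈-concat⁺′; ∈-concat⁻′; ∈-filter⁺; ∈-filter⁻;
   ∈-lookup; ∈-map⁺; ∈-map⁻)
open import Data.List.Membership.Propositional.Properties.WithK using (unique∧set⇒bag)
open import Data.List.Properties using
  (++-identityʳ; filter-++; filter-none; filter-≐; length-++; length-applyUpTo; length-map;
   map-cong; map-injective; map-∘; ∷-injective; ∷-injectiveˡ; ∷-injectiveʳ)
open import Data.List.Relation.Binary.BagAndSetEquality using (∼bag⇒↭)
open import Data.List.Relation.Binary.Disjoint.Propositional using (Disjoint)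
open import Data.List.Relation.Binary.Permutation.Propositional.Properties using (↭-length)
open import Data.List.Relation.Unary.All as All using (All; []; _∷_; all?)
import Data.List.Relation.Unary.All.Properties as All
open import Data.List.Relation.Unary.AllPairs as AllPairs using (AllPairs; []; _∷_)
import Data.List.Relation.Unary.AllPairs.Properties as AllPairs
open import Data.List.Relation.Unary.Any as Any using (Any; here; there)
import Data.List.Relation.Unary.Any.Properties as Any
open import Data.List.Relation.Unary.Linked as Linked using (Linked; []; [-]; _∷_)
open import Data.List.Relation.Unary.Unique.Propositional using (Unique)
import Data.List.Relation.Unary.Unique.Propositional.Properties as Unique
open import Data.Nat.Base using
  (ℕ; zero; suc; _+_; _*_; _∸_; _≤_; _<_; _≥_; z≤n; s≤s; s≤s⁻¹; z<s)
open import Data.Nat.Combinatorics using (_C_; nCk+nC[k+1]≡[n+1]C[k+1]; k>n⇒nCk≡0)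
open import Data.Nat.DivMod using (_/_; m*n/n≡m)
open import Data.Nat.ListAction using (sum)
open import Data.Nat.Properties
open import Data.Nat.Tactic.RingSolver using (solve-∀)
open import Data.Product.Base using (_×_; _,_; proj₁; proj₂; ∃; ∃₂)
open import Data.Product.Properties using (,-injectiveˡ; ,-injectiveʳ)
open import Data.Sum.Base using (_⊎_; inj₁; inj₂; [_,_])
open import Data.Unit.Base using (⊤; tt)
open import Data.Vec.Base as Vec using (Vec; []; _∷_)
open import Function.Base using (_∘_)
open import Function.Bundles using (_⇔_; mk⇔; Equivalence)
open import Function.Definitions using (Injective; Surjective; Bijective)
open import Level using (0ℓ)
open import Relation.Binary.Core using (Rel)
open import Relation.Binary.Definitions using (tri<; tri≈; tri>)
open import Relation.Binary.PropositionalEquality using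
  (_≡_; _≢_; refl; sym; trans; cong; cong₂; subst; subst₂; ≢-sym; module ≡-Reasoning)
open import Relation.Nullary.Decidable using (yes; no; does; _×-dec_)
open import Relation.Nullary.Negation using (¬_; contradiction)
open import Relation.Unary using (Pred; Decidable; _≐_)

-- Counting Dyck paths

-- `Contains` speaks of index vectors and order equivalences, which suit no induction on lists. Both
-- patterns begin with a larger entry `x` and a smaller entry `y`, so for distinct entries avoiding
-- both is one condition on values: everything after such a pair lies strictly between `y` and `x`.
-- In this form the condition passes to tails at once. A tail of a permutation of 1, ..., n is no
-- longer one of an initial interval, however, so the lower end of the interval of values is left
-- free and a minimal head can be peeled off. Labels and path interact only through the ascent
-- condition. Once the permutation is fixed, that condition concerns the unlabelled path alone, so
-- the labelled paths become a disjoint union of products of a list of permutations with a list of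
-- paths. In the reflection count the reflected term stays on the left as a summand, since
-- subtraction in ℕ is truncated.

module _ {A : Set} {P : Pred A 0ℓ} (P? : Decidable P) where

  count-++ : ∀ xs ys → count P? (xs ++ ys) ≡ count P? xs + count P? ys
  count-++ xs ys = trans (cong length (filter-++ P? xs ys)) (length-++ (filter P? xs))

  count-map : ∀ {B : Set} (f : B → A) xs → count P? (map f xs) ≡ count (P? ∘ f) xs
  count-map f []       = refl
  count-map f (x ∷ xs) with does (P? (f x))
  ... | true  = cong suc (count-map f xs)
  ... | false = count-map f xs

  count-≐ : ∀ {Q : Pred A 0ℓ} (Q? : Decidable Q) → P ≐ Q → ∀ xs → count P? xs ≡ count Q? xs
  count-≐ Q? P≐Q xs = cong length (filter-≐ P? Q? P≐Q xs)

  count-none : (∀ x → ¬ P x) → ∀ xs → count P? xs ≡ 0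
  count-none ¬P xs = cong length (filter-none P? (All.universal ¬P xs))

NE-words : ℕ → List (List (Step ⊤))
NE-words = words (N tt ∷ E ∷ [])

count-words-suc : ∀ {P : Pred (List (Step ⊤)) 0ℓ} (P? : Decidable P) k →
  count P? (NE-words (suc k)) ≡
  count (P? ∘ (N tt ∷_)) (NE-words k) + count (P? ∘ (E ∷_)) (NE-words k)
count-words-suc P? k = begin
  count P? (map (N tt ∷_) ws ++ map (E ∷_) ws ++ [])
    ≡⟨ cong (λ v → count P? (map (N tt ∷_) ws ++ v)) (++-identityʳ _) ⟩
  count P? (map (N tt ∷_) ws ++ map (E ∷_) ws)
    ≡⟨ count-++ P? (map (N tt ∷_) ws) _ ⟩
  count P? (map (N tt ∷_) ws) + count P? (map (E ∷_) ws)
    ≡⟨ cong₂ _+_ (count-map P? _ ws) (count-map P? _ ws) ⟩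
  count (P? ∘ (N tt ∷_)) ws + count (P? ∘ (E ∷_)) ws ∎
  where
  open ≡-Reasoning
  ws = NE-words k

-- Paths with p north and q east steps that start at height d above the
-- diagonal; d = 0 and p = q = n gives IsDyck n.
Ballot : (d p q : ℕ) → Pred (List (Step ⊤)) 0ℓ
Ballot d p q w =
  norths w ≡ p × easts w ≡ q × All (λ u → easts u ≤ d + norths u) (inits w)

ballot? : ∀ d p q → Decidable (Ballot d p q)
ballot? d p q w =
  (norths w ≟ p) ×-dec (easts w ≟ q) ×-dec all? (λ u → easts u ≤? d + norths u) (inits w)

-- Dropping the first step moves the starting height, up after a north step and down after an east
-- step; hence the height `suc d` in `ballot-E`.
ballot-N : ∀ d p q → (Ballot d (suc p) q ∘ (N tt ∷_)) ≐ Ballot (suc d) p q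
ballot-N d p q =
  (λ { (np , eq , _ ∷ b) → suc-injective np , eq ,
       All.map (λ {u} → subst (easts u ≤_) (+-suc d _)) (All.map⁻ b) }) ,
  (λ { (np , eq , b) → cong suc np , eq ,
       z≤n ∷ All.map⁺ (All.map (λ {u} → subst (easts u ≤_) (sym (+-suc d _))) b) })

ballot-E : ∀ d p q → (Ballot (suc d) p (suc q) ∘ (E ∷_)) ≐ Ballot d p q
ballot-E d p q =
  (λ { (np , eq , _ ∷ b) → np , suc-injective eq , All.map s≤s⁻¹ (All.map⁻ b) }) ,
  (λ { (np , eq , b) → np , cong suc eq , z≤n ∷ All.map⁺ (All.map s≤s b) })

ballots : (d p q k : ℕ) → ℕ
ballots d p q k = count (ballot? d p q) (NE-words k)

-- The reflection principle: a path from height d that reaches height -1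
-- corresponds to a path from height -2-d with the same end point, which
-- has p + d + 1 north steps.
mutual
  ballots-reflection : ∀ k d p q → p + q ≡ k → q ≤ p + d →
    ballots d p q k + k C suc (p + d) ≡ k C p
  ballots-reflection zero    d zero    zero eq q≤ =
    cong suc (k>n⇒nCk≡0 {0} {suc d} (s≤s z≤n))
  ballots-reflection (suc k) d p       q    eq q≤ = begin
    ballots d p q (suc k) + suc k C suc (p + d)
      ≡⟨ cong₂ _+_ (count-words-suc (ballot? d p q) k) (sym (nCk+nC[k+1]≡[n+1]C[k+1] k (p + d))) ⟩
    (bN + bE) + (k C (p + d) + k C suc (p + d))
      -- Reflection exchanges north and east at the first step. Paths that begin north are therefore
      -- paired with reflected paths that begin east and still have `suc (p + d)` north steps to
      -- come, and vice versa.
      ≡⟨ interchange bN bE _ _ ⟩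
    (bN + k C suc (p + d)) + (bE + k C (p + d))
      ≡⟨ cong ((bN + k C suc (p + d)) +_) (ballots-E k d p q eq q≤) ⟩
    (bN + k C suc (p + d)) + k C p
      ≡⟨ ballots-N k d p q eq q≤ ⟩
    suc k C p ∎
    where
    open ≡-Reasoning
    bN = count (ballot? d p q ∘ (N tt ∷_)) (NE-words k)
    bE = count (ballot? d p q ∘ (E ∷_)) (NE-words k)
    interchange : ∀ a b c d → (a + b) + (c + d) ≡ (a + d) + (b + c)
    interchange = solve-∀

  -- The summand `k C p` on the left lets Pascal's rule give `suc k C p`, where the bare count would
  -- need the predecessor of `p`. The case `p = 0` then fits the same statement.
  ballots-N : ∀ k d p q → p + q ≡ suc k → q ≤ p + d →
    count (ballot? d p q ∘ (N tt ∷_)) (NE-words k) + k C suc (p + d) + k C p ≡ suc k C p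
  ballots-N k d zero    q refl q≤ = cong₂ (λ a b → a + b + 1)
    (count-none (ballot? d 0 q ∘ (N tt ∷_)) (λ { w (() , _) }) (NE-words k))
    (k>n⇒nCk≡0 (m≤n⇒m≤1+n q≤))
  ballots-N k d (suc p) q eq   q≤ = begin
    count (ballot? d (suc p) q ∘ (N tt ∷_)) (NE-words k) + k C suc (suc p + d) + k C suc p
      ≡⟨ cong₂ (λ a b → a + k C suc b + k C suc p)
           (count-≐ _ (ballot? (suc d) p q) (ballot-N d p q) (NE-words k)) (sym (+-suc p d)) ⟩
    ballots (suc d) p q k + k C suc (p + suc d) + k C suc p
      ≡⟨ cong (_+ k C suc p) (ballots-reflection k (suc d) p q (suc-injective eq)
           (subst (q ≤_) (sym (+-suc p d)) q≤)) ⟩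
    k C p + k C suc p
      ≡⟨ nCk+nC[k+1]≡[n+1]C[k+1] k p ⟩
    suc k C suc p ∎
    where open ≡-Reasoning

  -- At height 0 a first east step is forbidden, and the reflected term is already the whole
  -- right-hand side. With no east step available, `p` exceeds `k` and every term vanishes.
  -- Otherwise the start drops by one.
  ballots-E : ∀ k d p q → p + q ≡ suc k → q ≤ p + d →
    count (ballot? d p q ∘ (E ∷_)) (NE-words k) + k C (p + d) ≡ k C p
  ballots-E k zero    p q       eq q≤ = cong₂ (λ a b → a + k C b)
    (count-none (ballot? 0 p q ∘ (E ∷_)) (λ { w (_ , _ , _ ∷ () ∷ _) }) (NE-words k))
    (+-identityʳ p)
  ballots-E k (suc d) p zero    eq q≤ = trans
    (cong₂ _+_
      (count-none (ballot? (suc d) p 0 ∘ (E ∷_)) (λ { w (_ , () , _) }) (NE-words k))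
      (k>n⇒nCk≡0 (≤-trans k<p (m≤m+n p (suc d)))))
    (sym (k>n⇒nCk≡0 k<p))
    where
    k<p : k < p
    k<p = ≤-reflexive (trans (sym eq) (+-identityʳ p))
  ballots-E k (suc d) p (suc q) eq q≤ = begin
    count (ballot? (suc d) p (suc q) ∘ (E ∷_)) (NE-words k) + k C (p + suc d)
      ≡⟨ cong₂ (λ a b → a + k C b)
           (count-≐ _ (ballot? d p q) (ballot-E d p q) (NE-words k)) (+-suc p d) ⟩
    ballots d p q k + k C suc (p + d)
      ≡⟨ ballots-reflection k d p q (suc-injective (trans (sym (+-suc p q)) eq))
           (s≤s⁻¹ (subst (suc q ≤_) (+-suc p d) q≤)) ⟩
    k C p ∎
    where open ≡-Reasoning

-- For the Catalan formula: at `n + n` and `n`, together with Pascal's rule, it ties the reflected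
-- binomial to the central one. In the induction one copy of `c` is split off, which lowers its
-- factor to the one that the induction hypothesis needs.
C-absorption : ∀ n k → suc k * (suc n C suc k) ≡ suc n * (n C k)
C-absorption zero    zero    = refl
C-absorption zero    (suc k) = begin
  suc (suc k) * (1 C suc (suc k)) ≡⟨ cong (suc (suc k) *_) (k>n⇒nCk≡0 {1} {suc (suc k)} (s≤s (s≤s z≤n))) ⟩
  suc (suc k) * 0                 ≡⟨ *-zeroʳ (suc (suc k)) ⟩
  0                               ≡⟨ k>n⇒nCk≡0 {0} {suc k} (s≤s z≤n) ⟨
  0 C suc k                       ≡⟨ +-identityʳ (0 C suc k) ⟨
  0 C suc k + 0                   ∎
  where open ≡-Reasoning
C-absorption (suc n) zero    = begin
  1 * (suc (suc n) C 1)            ≡⟨ cong (1 *_) (nCk+nC[k+1]≡[n+1]C[k+1] (suc n) 0) ⟨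
  1 * (1 + suc n C 1)              ≡⟨ *-distribˡ-+ 1 1 (suc n C 1) ⟩
  1 + 1 * (suc n C 1)              ≡⟨ cong (1 +_) (C-absorption n 0) ⟩
  1 + suc n * 1                    ∎
  where open ≡-Reasoning
C-absorption (suc n) (suc k) = begin
  suc (suc k) * (suc (suc n) C suc (suc k))
    ≡⟨ cong (suc (suc k) *_) (nCk+nC[k+1]≡[n+1]C[k+1] (suc n) (suc k)) ⟨
  suc (suc k) * (c + suc n C suc (suc k))
    ≡⟨ expand k c (suc n C suc (suc k)) ⟩
  c + (suc k * c + suc (suc k) * (suc n C suc (suc k)))
    ≡⟨ cong (c +_) (cong₂ _+_ (C-absorption n k) (C-absorption n (suc k))) ⟩
  c + (suc n * (n C k) + suc n * (n C suc k))
    ≡⟨ cong (c +_) (*-distribˡ-+ (suc n) (n C k) _) ⟨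
  c + suc n * (n C k + n C suc k)
    ≡⟨ cong (λ x → c + suc n * x) (nCk+nC[k+1]≡[n+1]C[k+1] n k) ⟩
  suc (suc n) * c ∎
  where
  open ≡-Reasoning
  c = suc n C suc k
  expand : ∀ k x y → suc (suc k) * (x + y) ≡ x + (suc k * x + suc (suc k) * y)
  expand = solve-∀

dyckPaths : ℕ → List (List (Step ⊤))
dyckPaths n = filter (isDyck? n) (paths n)

length-dyckPaths : ∀ n → length (dyckPaths n) ≡ catalan n
length-dyckPaths n = begin
  D                              ≡⟨ m*n/n≡m D (suc n) ⟨
  D * suc n / suc n              ≡⟨ cong (_/ suc n) (*-comm D (suc n)) ⟩
  suc n * D / suc n              ≡⟨ cong (_/ suc n) (+-cancelʳ-≡ (suc n * (C′ + M)) (suc n * D) M times) ⟩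
  M / suc n                      ≡⟨ cong (λ k → (k C n) / suc n) (cong (n +_) (+-identityʳ n)) ⟨
  catalan n                      ∎
  where
  open ≡-Reasoning
  D C′ M : ℕ
  D  = length (dyckPaths n)
  C′ = (n + n) C suc n
  M  = (n + n) C n

  D+C′≡M : D + C′ ≡ M
  D+C′≡M = begin
    D + (n + n) C suc n
      ≡⟨ cong₂ (λ a b → a + (n + n) C suc b)
           (count-≐ (isDyck? n) (ballot? 0 n n) ((λ p → p) , (λ p → p)) (paths n))
           (sym (+-identityʳ n)) ⟩
    ballots 0 n n (n + n) + (n + n) C suc (n + 0)
      ≡⟨ ballots-reflection (n + n) 0 n n refl (m≤m+n n 0) ⟩
    M ∎

  -- The summand added on both sides makes `D + C′` and `M + C′` appear without subtraction;
  -- cancelling it leaves `suc n * D ≡ M`.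
  times : suc n * D + suc n * (C′ + M) ≡ M + suc n * (C′ + M)
  times = begin
    suc n * D + suc n * (C′ + M)       ≡⟨ lhs n D C′ M ⟩
    suc n * (D + C′) + suc n * M       ≡⟨ cong (λ x → suc n * x + suc n * M) D+C′≡M ⟩
    suc n * M + suc n * M              ≡⟨ rhs n M ⟩
    M + suc (n + n) * M                ≡⟨ cong (M +_) (C-absorption (n + n) n) ⟨
    M + suc n * (suc (n + n) C suc n)  ≡⟨ cong (λ x → M + suc n * x) (nCk+nC[k+1]≡[n+1]C[k+1] (n + n) n) ⟨
    M + suc n * (M + C′)               ≡⟨ cong (λ x → M + suc n * x) (+-comm M C′) ⟩
    M + suc n * (C′ + M)               ∎
    where
    lhs : ∀ n d c m → suc n * d + suc n * (c + m) ≡ suc n * (d + c) + suc n * m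
    lhs = solve-∀
    rhs : ∀ n m → suc n * m + suc n * m ≡ m + suc (n + n) * m
    rhs = solve-∀

-- Permutations avoiding 213 and 321

Increasing : List ℕ → Set
Increasing = AllPairs _<_

increasing⇒unique : ∀ {xs} → Increasing xs → Unique xs
increasing⇒unique = AllPairs.map <⇒≢

-- The ternary counterpart of `AllPairs`, over entries in order of position.
Triples : (ℕ → ℕ → ℕ → Set) → List ℕ → Set
Triples R []       = ⊤
Triples R (x ∷ xs) = AllPairs (R x) xs × Triples R xs

-- For distinct entries x y z, in this order, this excludes exactly the
-- patterns 213 and 321.
Between : ℕ → ℕ → ℕ → Set
Between x y z = y < x → y < z × z < x

-- Combined with `Unique`, this makes the list a permutation of the half-open interval from `p` to
-- `q`.
Spans : List ℕ → ℕ → ℕ → Set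
Spans xs p q = (∀ {v} → v ∈ xs → p ≤ v × v < q) × (∀ {v} → p ≤ v → v < q → v ∈ xs)

spans-cons : ∀ {a xs q} → a < q → Spans xs (suc a) q → Spans (a ∷ xs) a q
spans-cons {a} {xs} {q} a<q (to , from) =
  (λ { (here refl) → ≤-refl , a<q
     ; (there v∈)  → let a<v , v<q = to v∈ in <⇒≤ a<v , v<q }) ,
  into
  where
  into : ∀ {v} → a ≤ v → v < q → v ∈ a ∷ xs
  into a≤v v<q with m≤n⇒m<n∨m≡n a≤v
  ... | inj₁ a<v  = there (from a<v v<q)
  ... | inj₂ refl = here refl

spans-tail : ∀ {a xs q} → All (a ≢_) xs → Spans (a ∷ xs) a q → Spans xs (suc a) q
spans-tail {a} {xs} {q} a∉ (to , from) =
  (λ v∈ → let a≤v , v<q = to (there v∈) in ≤∧≢⇒< a≤v (All.lookup a∉ v∈) , v<q) , out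
  where
  out : ∀ {v} → suc a ≤ v → v < q → v ∈ xs
  out a<v v<q with from (<⇒≤ a<v) v<q
  ... | here refl = contradiction a<v (<-irrefl refl)
  ... | there v∈  = v∈

range : ℕ → ℕ → List ℕ
range a zero    = []
range a (suc k) = a ∷ range (suc a) k

range-spans : ∀ a k → Spans (range a k) a (a + k)
range-spans a zero    =
  (λ ()) , λ a≤v v<a → contradiction (<-≤-trans (subst (_ <_) (+-identityʳ a) v<a) a≤v) (<-irrefl refl)
range-spans a (suc k) = spans-cons (m<m+n a z<s)
  (subst (Spans (range (suc a) k) (suc a)) (sym (+-suc a k)) (range-spans (suc a) k))

range-increasing : ∀ a k → Increasing (range a k)
range-increasing a zero    = []
range-increasing a (suc k) =
  All.tabulate (proj₁ ∘ proj₁ (range-spans (suc a) k)) ∷ range-increasing (suc a) k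

-- Each head is the least entry of its list, so equal sets of entries force equal heads; strictness
-- keeps the common head out of both tails.
increasing-≡ : ∀ {xs ys} → Increasing xs → Increasing ys →
  (∀ {v} → v ∈ xs → v ∈ ys) → (∀ {v} → v ∈ ys → v ∈ xs) → xs ≡ ys
increasing-≡ {[]}     {[]}     _        _        _ _ = refl
increasing-≡ {[]}     {y ∷ ys} _        _        _ g with () ← g (here refl)
increasing-≡ {x ∷ xs} {[]}     _        _        f _ with () ← f (here refl)
increasing-≡ {x ∷ xs} {y ∷ ys} (x< ∷ xs↗) (y< ∷ ys↗) f g =
  cong₂ _∷_ x≡y (increasing-≡ xs↗ ys↗ f′ g′)
  where
  x≡y : x ≡ y
  x≡y with f (here refl) | g (here refl)
  ... | here eq   | _         = eq
  ... | there _   | here eq   = sym eq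
  ... | there x∈  | there y∈  = contradiction (All.lookup x< y∈) (<-asym (All.lookup y< x∈))

  f′ : ∀ {v} → v ∈ xs → v ∈ ys
  f′ v∈ with f (there v∈)
  ... | there v∈′ = v∈′
  ... | here refl = contradiction (All.lookup x< v∈) (<-irrefl x≡y)

  g′ : ∀ {v} → v ∈ ys → v ∈ xs
  g′ v∈ with g (there v∈)
  ... | there v∈′ = v∈′
  ... | here refl = contradiction (All.lookup y< v∈) (<-irrefl (sym x≡y))

increasing-spans-≡ : ∀ {xs a k} → Increasing xs → Spans xs a (a + k) → xs ≡ range a k
increasing-spans-≡ {a = a} {k} xs↗ (to , from) =
  let to′ , from′ = range-spans a k in
  increasing-≡ xs↗ (range-increasing a k)
    (λ v∈ → let p , q = to v∈ in from′ p q) (λ v∈ → let p , q = to′ v∈ in from p q)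

-- For t, b ≥ 1, the permutations of {a, …, a+i+t+b-1} with one descent that avoid
-- 213 and 321: the values are cut into consecutive intervals of sizes
-- i, b and t, and the last two are swapped.
block : (a i t b : ℕ) → List ℕ
block a zero    t b = range (a + b) t ++ range a b
block a (suc i) t b = a ∷ block (suc a) i t b

block-spans : ∀ a i t b → Spans (block a i t b) a (a + (i + (t + b)))
block-spans a zero t b = to , from
  where
  a+b+t : a + b + t ≡ a + (t + b)
  a+b+t = trans (+-assoc a b t) (cong (a +_) (+-comm b t))

  to : ∀ {v} → v ∈ block a 0 t b → a ≤ v × v < a + (t + b)
  to {v} v∈ with ∈-++⁻ (range (a + b) t) v∈
  ... | inj₁ v∈ˡ = let p , q = proj₁ (range-spans (a + b) t) v∈ˡ in
                   ≤-trans (m≤m+n a b) p , subst (v <_) a+b+t q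
  ... | inj₂ v∈ʳ = let p , q = proj₁ (range-spans a b) v∈ʳ in
                   p , <-≤-trans q (+-monoʳ-≤ a (m≤n+m b t))

  from : ∀ {v} → a ≤ v → v < a + (t + b) → v ∈ block a 0 t b
  from {v} p q with v <? a + b
  ... | yes v< = ∈-++⁺ʳ (range (a + b) t) (proj₂ (range-spans a b) p v<)
  ... | no  v≮ = ∈-++⁺ˡ (proj₂ (range-spans (a + b) t) (≮⇒≥ v≮) (subst (v <_) (sym a+b+t) q))
block-spans a (suc i) t b = spans-cons (m<m+n a z<s)
  (subst (Spans (block (suc a) i t b) (suc a)) (sym (+-suc a _)) (block-spans (suc a) i t b))

range-above : ∀ a b t → All (λ x → All (_< x) (range a b)) (range (a + b) t)
range-above a b t = All.tabulate λ x∈ → All.tabulate λ y∈ →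
  <-≤-trans (proj₂ (proj₁ (range-spans a b) y∈)) (proj₁ (proj₁ (range-spans (a + b) t) x∈))

block-unique : ∀ a i t b → Unique (block a i t b)
block-unique a zero    t b = AllPairs.++⁺
  (increasing⇒unique (range-increasing (a + b) t))
  (increasing⇒unique (range-increasing a b))
  (All.map (All.map >⇒≢) (range-above a b t))
block-unique a (suc i) t b =
  All.tabulate (<⇒≢ ∘ proj₁ ∘ proj₁ (block-spans (suc a) i t b)) ∷ block-unique (suc a) i t b

min-between : ∀ {x xs} → All (x <_) xs → AllPairs (Between x) xs
min-between []         = []
min-between (x<y ∷ x<) =
  All.map (λ _ y<x → contradiction y<x (<-asym x<y)) x< ∷ min-between x<

increasing-between : ∀ {xs} → Increasing xs → Triples Between xs
increasing-between []         = tt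
increasing-between (x< ∷ xs↗) = min-between x< , increasing-between xs↗

-- A larger entry precedes a smaller one only when the first is in `xs` and the second in `ys`. Any
-- later entry is then in `ys` too, above the second because `ys` increases and below the first
-- because all of `ys` is.
++-between : ∀ {xs ys} → Increasing xs → Increasing ys →
  All (λ x → All (_< x) ys) xs → Triples Between (xs ++ ys)
++-between []         ys↗ _            = increasing-between ys↗
++-between {x ∷ xs} {ys} (x< ∷ xs↗) ys↗ (ys<x ∷ ys<) =
  AllPairs.++⁺ (min-between x<) (ys-between ys↗ ys<x)
    (All.map (λ x<y → All.universal (λ _ y<x → contradiction y<x (<-asym x<y)) ys) x<) ,
  ++-between xs↗ ys↗ ys<
  where
  ys-between : ∀ {zs} → Increasing zs → All (_< x) zs → AllPairs (Between x) zs
  ys-between []         []          = []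
  ys-between (y< ∷ zs↗) (_ ∷ zs<x) =
    All.zipWith (λ yz,zx _ → yz,zx) (y< , zs<x) ∷ ys-between zs↗ zs<x

block-between : ∀ a i t b → Triples Between (block a i t b)
block-between a zero    t b =
  ++-between (range-increasing (a + b) t) (range-increasing a b) (range-above a b t)
block-between a (suc i) t b =
  min-between (All.tabulate (proj₁ ∘ proj₁ (block-spans (suc a) i t b))) ,
  block-between (suc a) i t b

allPairs-before : ∀ {R : Rel ℕ 0ℓ} xs {y ys} → AllPairs R (xs ++ y ∷ ys) → All (λ x → R x y) xs
allPairs-before []       _          = []
allPairs-before (x ∷ xs) (Rx ∷ Rxs) =
  All.head (All.++⁻ʳ xs Rx) ∷ allPairs-before xs Rxs

-- The entries above x precede those below x by 213, the former increase
-- by 321 with an entry below x in the role of 1, the latter by 321 with x in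
-- the role of 3.
split-below : ∀ {x xs} → Unique (x ∷ xs) → Triples Between (x ∷ xs) → Any (_< x) xs →
  ∃ λ ls → ∃₂ λ s ss →
    xs ≡ ls ++ s ∷ ss × Increasing (x ∷ ls) × Increasing (s ∷ ss) × All (_< x) (s ∷ ss)
split-below {x} {u ∷ us} ((x≢u ∷ x∉) ∷ u∉ ∷ !us) (xu ∷ xus , uus , t) below with <-cmp u x
... | tri≈ _ u≡x _ = contradiction (sym u≡x) x≢u
... | tri< u<x _ _ =
  [] , u , us , refl , [] ∷ [] ,
  All.map (λ f → proj₁ (f u<x)) xu ∷ increasing xus us<x , u<x ∷ us<x
  where
  us<x : All (_< x) us
  us<x = All.map (λ f → proj₂ (f u<x)) xu

  increasing : ∀ {zs} → AllPairs (Between x) zs → All (_< x) zs → Increasing zs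
  increasing []         _            = []
  increasing (xz ∷ xzs) (z<x ∷ zs<x) =
    All.map (λ f → proj₁ (f z<x)) xz ∷ increasing xzs zs<x
... | tri> u≮x _ x<u with split-below (x∉ ∷ !us) (xus , t) (Any.tail u≮x below)
...   | ls , s , ss , refl , x<ls ∷ ls↗ , ss↗ , s<x ∷ ss<x =
  u ∷ ls , s , ss , refl , (x<u ∷ x<ls) ∷ u<ls ∷ ls↗ , ss↗ , s<x ∷ ss<x
  where
  u<ls : All (u <_) ls
  u<ls = All.tabulate λ {v} v∈ →
    ≤∧≢⇒< (≮⇒≥ λ v<u → <-asym (<-trans s<x (All.lookup x<ls v∈))
                         (proj₁ (All.lookup (allPairs-before ls uus) v∈ v<u)))
          (All.lookup (All.++⁻ˡ ls u∉) v∈)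

-- The successors keep both swapped intervals nonempty; with an empty one the block would degenerate
-- to a `range`.
IsBlock : List ℕ → (a k : ℕ) → Set
IsBlock xs a k = ∃ λ i → ∃₂ λ t b →
  i + (suc t + suc b) ≡ k × xs ≡ block a i (suc t) (suc b)

<⇒∃+suc : ∀ {m n} → m < n → ∃ λ k → n ≡ m + suc k
<⇒∃+suc {m} m<n = let k , eq = m≤n⇒∃[o]m+o≡n m<n in k , trans (sym eq) (sym (+-suc m k))

-- A head equal to the minimum `a` is peeled off and either lengthens the range or raises `i` by
-- one. If the head `x` is larger, `a` occurs later, so `split-below` applies: its two increasing
-- pieces contain the values from `x` on and the values below `x`, and are therefore ranges.
range-or-block : ∀ a k xs → Unique xs → Triples Between xs → Spans xs a (a + k) →
  xs ≡ range a k ⊎ IsBlock xs a k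
range-or-block a zero    []       _ _ _ = inj₁ refl
range-or-block a (suc k) []       _ _ (_ , from) with () ← from ≤-refl (m<m+n a z<s)
range-or-block a k       (x ∷ xs) (x∉ ∷ !xs) (xxs , t) sp@(to , from)
  with m≤n⇒m<n∨m≡n (proj₁ (to (here refl)))
range-or-block a zero    (x ∷ xs) (x∉ ∷ !xs) (xxs , t) sp@(to , from) | inj₂ refl =
  contradiction (proj₂ (to (here refl))) (<-irrefl (sym (+-identityʳ a)))
range-or-block a (suc k) (x ∷ xs) (x∉ ∷ !xs) (xxs , t) sp@(to , from) | inj₂ refl
  with range-or-block (suc a) k xs !xs t (subst (Spans xs (suc a)) (+-suc a k) (spans-tail x∉ sp))
... | inj₁ refl                       = inj₁ refl
... | inj₂ (i , t , b , refl , refl)  = inj₂ (suc i , t , b , refl , refl)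
range-or-block a k       (x ∷ xs) (x∉ ∷ !xs) (xxs , t) sp@(to , from) | inj₁ a<x
  with split-below (x∉ ∷ !xs) (xxs , t) a-below
  where
  a-below : Any (_< x) xs
  a-below with from ≤-refl (<-trans a<x (proj₂ (to (here refl))))
  ... | here refl = contradiction a<x (<-irrefl refl)
  ... | there a∈  = Any.map (λ { refl → a<x }) a∈
... | ls , s , ss , refl , x<ls ∷ ls↗ , ss↗ , ss<x
  -- The distance from `a` to `x` is the size of the lower interval, that from `x` to `a + k` the
  -- size of the upper one.
  with <⇒∃+suc a<x | <⇒∃+suc (proj₂ (to (here refl)))
... | b , refl | t , eq = inj₂ (0 , t , b , t+b≡k , cong₂ _++_
  (increasing-spans-≡ (x<ls ∷ ls↗) (to-ls , from-ls))
  (increasing-spans-≡ ss↗ (to-ss , from-ss)))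
  where
  open ≡-Reasoning
  t+b≡k : suc t + suc b ≡ k
  t+b≡k = +-cancelˡ-≡ a _ _ (begin
    a + (suc t + suc b)   ≡⟨ cong (a +_) (+-comm (suc t) (suc b)) ⟩
    a + (suc b + suc t)   ≡⟨ +-assoc a (suc b) (suc t) ⟨
    a + suc b + suc t     ≡⟨ eq ⟨
    a + k                 ∎)

  to-ls : ∀ {v} → v ∈ x ∷ ls → x ≤ v × v < x + suc t
  to-ls {v} v∈ =
    All.lookup (≤-refl ∷ All.map <⇒≤ x<ls) v∈ , subst (v <_) eq (proj₂ (to (∈-++⁺ˡ v∈)))

  from-ls : ∀ {v} → x ≤ v → v < x + suc t → v ∈ x ∷ ls
  from-ls {v} x≤v v< with ∈-++⁻ (x ∷ ls) (from (≤-trans (<⇒≤ a<x) x≤v) (subst (v <_) (sym eq) v<))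
  ... | inj₁ v∈ = v∈
  ... | inj₂ v∈ = contradiction (All.lookup ss<x v∈) (≤⇒≯ x≤v)

  to-ss : ∀ {v} → v ∈ s ∷ ss → a ≤ v × v < x
  to-ss v∈ = proj₁ (to (∈-++⁺ʳ (x ∷ ls) v∈)) , All.lookup ss<x v∈

  from-ss : ∀ {v} → a ≤ v → v < x → v ∈ s ∷ ss
  from-ss a≤v v<x with ∈-++⁻ (x ∷ ls) (from a≤v (<-trans v<x (proj₂ (to (here refl)))))
  ... | inj₁ v∈ = contradiction (All.lookup (≤-refl ∷ All.map <⇒≤ x<ls) v∈) (<⇒≱ v<x)
  ... | inj₂ v∈ = v∈

-- Telling blocks apart: the jump and the descent

range≢block : ∀ a k i t b → range a k ≢ block a i (suc t) (suc b)
range≢block a (suc k) zero    t b eq = m≢1+m+n a (trans (∷-injectiveˡ eq) (+-suc a b))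
range≢block a (suc k) (suc i) t b eq = range≢block (suc a) k i t b (∷-injectiveʳ eq)

-- A block counts upward from `a` for exactly `i` entries and then jumps by `suc b`; comparing heads
-- locates this jump.
block-injective : ∀ a i i′ t t′ b b′ →
  block a i (suc t) (suc b) ≡ block a i′ (suc t′) (suc b′) → i ≡ i′
block-injective a zero    zero     t t′ b b′ eq = refl
block-injective a zero    (suc i′) t t′ b b′ eq =
  contradiction (trans (sym (∷-injectiveˡ eq)) (+-suc a b)) (m≢1+m+n a)
block-injective a (suc i) zero     t t′ b b′ eq =
  contradiction (trans (∷-injectiveˡ eq) (+-suc a b′)) (m≢1+m+n a)
block-injective a (suc i) (suc i′) t t′ b b′ eq =
  cong suc (block-injective (suc a) i i′ t t′ b b′ (∷-injectiveʳ eq))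

-- The index is the position, counted from 1, of the larger entry of the only descent. It is thus
-- the number of the north step carrying that entry, as in `NorthThenEast`.
data DescentAt : ℕ → List ℕ → Set where
  here  : ∀ {x y ys} → y < x → Increasing (y ∷ ys) → DescentAt 1 (x ∷ y ∷ ys)
  there : ∀ {m x y ys} → x < y → DescentAt m (y ∷ ys) → DescentAt (suc m) (x ∷ y ∷ ys)

descentAt-injective : ∀ {m m′ xs} → DescentAt m xs → DescentAt m′ xs → m ≡ m′
descentAt-injective (here _ _)    (here _ _)     = refl
descentAt-injective (here y<x _)  (there x<y _)  = contradiction x<y (<-asym y<x)
descentAt-injective (there x<y _) (here y<x _)   = contradiction x<y (<-asym y<x)
descentAt-injective (there _ d)   (there _ d′)   = cong suc (descentAt-injective d d′)

-- The recursion raises the start of the first range while the second stays at `a`, hence the free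
-- `c` above `a`.
descentAt-range-++-range : ∀ {a c} t b → a < c → DescentAt (suc t) (range c (suc t) ++ range a (suc b))
descentAt-range-++-range zero    b a<c = here a<c (range-increasing _ (suc b))
descentAt-range-++-range (suc t) b a<c = there (n<1+n _) (descentAt-range-++-range t b (m<n⇒m<1+n a<c))

descentAt-block : ∀ a i t b → DescentAt (i + suc t) (block a i (suc t) (suc b))
descentAt-block a zero          t b = descentAt-range-++-range t b (m<m+n a z<s)
-- After the last fixed entry comes the start of the upper interval, `suc a + suc b`, and not
-- `suc a` as in the next clause.
descentAt-block a (suc zero)    t b = there (s≤s (m≤m+n a (suc b))) (descentAt-block (suc a) 0 t b)
descentAt-block a (suc (suc i)) t b = there (n<1+n a) (descentAt-block (suc a) (suc i) t b)

-- Pattern containment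

module _ {A : Set} {R : Rel A 0ℓ} where

  allPairs-lookup : ∀ {xs} → AllPairs R xs →
    ∀ {i j} → i Fin.< j → R (lookup xs i) (lookup xs j)
  allPairs-lookup (Rx ∷ Rxs) {zero}  {suc j} i<j = All.lookup Rx (∈-lookup j)
  allPairs-lookup (Rx ∷ Rxs) {suc i} {suc j} i<j = allPairs-lookup Rxs (s≤s⁻¹ i<j)

  allPairs-tabulate : ∀ xs → (∀ {i j} → i Fin.< j → R (lookup xs i) (lookup xs j)) → AllPairs R xs
  allPairs-tabulate []       f = []
  allPairs-tabulate (x ∷ xs) f =
    All.tabulate (λ y∈ → subst (R x) (sym (Any.lookup-index y∈)) (f {zero} {suc (Any.index y∈)} z<s)) ∷
    allPairs-tabulate xs (λ i<j → f (s≤s i<j))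

lookup-injective : ∀ {A : Set} {xs : List A} → Unique xs → Injective _≡_ _≡_ (lookup xs)
lookup-injective !xs {i} {j} eq with Fin.<-cmp i j
... | tri< i<j _ _ = contradiction eq (allPairs-lookup !xs i<j)
... | tri≈ _ i≡j _ = i≡j
... | tri> _ _ j<i = contradiction (sym eq) (allPairs-lookup !xs j<i)

module _ {R : ℕ → ℕ → ℕ → Set} where

  triples-lookup : ∀ {xs} → Triples R xs →
    ∀ {i j k} → i Fin.< j → j Fin.< k → R (lookup xs i) (lookup xs j) (lookup xs k)
  triples-lookup {x ∷ xs} (Rx , _) {zero}  {suc j} {suc k} _   j<k = allPairs-lookup Rx (s≤s⁻¹ j<k)
  triples-lookup {x ∷ xs} (_ , t)  {suc i} {suc j} {suc k} i<j j<k =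
    triples-lookup t (s≤s⁻¹ i<j) (s≤s⁻¹ j<k)

  triples-tabulate : ∀ xs →
    (∀ {i j k} → i Fin.< j → j Fin.< k → R (lookup xs i) (lookup xs j) (lookup xs k)) →
    Triples R xs
  triples-tabulate []       f = tt
  triples-tabulate (x ∷ xs) f =
    allPairs-tabulate xs (λ j<k → f {zero} z<s (s≤s j<k)) ,
    triples-tabulate xs (λ i<j j<k → f (s≤s i<j) (s≤s j<k))

≤⇔≤-refl : ∀ {x p} → (x ≤ x) ⇔ (p ≤ p)
≤⇔≤-refl = mk⇔ (λ _ → ≤-refl) (λ _ → ≤-refl)

<<⇒≤⇔≤ : ∀ {x y p q} → x < y → p < q → (x ≤ y) ⇔ (p ≤ q)
<<⇒≤⇔≤ x<y p<q = mk⇔ (λ _ → <⇒≤ p<q) (λ _ → <⇒≤ x<y)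

>>⇒≤⇔≤ : ∀ {x y p q} → y < x → q < p → (x ≤ y) ⇔ (p ≤ q)
>>⇒≤⇔≤ y<x q<p = mk⇔ (λ x≤y → contradiction x≤y (<⇒≱ y<x)) (λ p≤q → contradiction p≤q (<⇒≱ q<p))

module _ (π : List ℕ) where

  private
    increasing-indices : ∀ {i j k : Fin (length π)} → i Fin.< j → j Fin.< k →
      ∀ a b → a Fin.< b → Vec.lookup (i ∷ j ∷ k ∷ []) a Fin.< Vec.lookup (i ∷ j ∷ k ∷ []) b
    increasing-indices i<j j<k zero          (suc zero)       _ = i<j
    increasing-indices i<j j<k zero          (suc (suc zero)) _ = <-trans i<j j<k
    increasing-indices i<j j<k (suc zero)    (suc (suc zero)) _ = j<k
    increasing-indices i<j j<k (suc zero)    (suc zero)       a<b = contradiction a<b (<-irrefl refl)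
    increasing-indices i<j j<k (suc (suc zero)) (suc zero)       (s≤s ())
    increasing-indices i<j j<k (suc (suc zero)) (suc (suc zero)) (s≤s (s≤s ()))

  contains-213 : ∀ {i j k} → i Fin.< j → j Fin.< k →
    lookup π j < lookup π i → lookup π i < lookup π k → Contains π (2 ∷ 1 ∷ 3 ∷ [])
  contains-213 {i} {j} {k} i<j j<k y<x x<z = i ∷ j ∷ k ∷ [] , increasing-indices i<j j<k , same-order
    where
    same-order : ∀ a b →
      (lookup π (Vec.lookup (i ∷ j ∷ k ∷ []) a) ≤ lookup π (Vec.lookup (i ∷ j ∷ k ∷ []) b))
        ⇔ (lookup (2 ∷ 1 ∷ 3 ∷ []) a ≤ lookup (2 ∷ 1 ∷ 3 ∷ []) b)
    same-order zero             zero             = ≤⇔≤-refl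
    same-order zero             (suc zero)       = >>⇒≤⇔≤ y<x (<ᵇ⇒< 1 2 tt)
    same-order zero             (suc (suc zero)) = <<⇒≤⇔≤ x<z (<ᵇ⇒< 2 3 tt)
    same-order (suc zero)       zero             = <<⇒≤⇔≤ y<x (<ᵇ⇒< 1 2 tt)
    same-order (suc zero)       (suc zero)       = ≤⇔≤-refl
    same-order (suc zero)       (suc (suc zero)) = <<⇒≤⇔≤ (<-trans y<x x<z) (<ᵇ⇒< 1 3 tt)
    same-order (suc (suc zero)) zero             = >>⇒≤⇔≤ x<z (<ᵇ⇒< 2 3 tt)
    same-order (suc (suc zero)) (suc zero)       = >>⇒≤⇔≤ (<-trans y<x x<z) (<ᵇ⇒< 1 3 tt)
    same-order (suc (suc zero)) (suc (suc zero)) = ≤⇔≤-refl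

  contains-321 : ∀ {i j k} → i Fin.< j → j Fin.< k →
    lookup π j < lookup π i → lookup π k < lookup π j → Contains π (3 ∷ 2 ∷ 1 ∷ [])
  contains-321 {i} {j} {k} i<j j<k y<x z<y = i ∷ j ∷ k ∷ [] , increasing-indices i<j j<k , same-order
    where
    same-order : ∀ a b →
      (lookup π (Vec.lookup (i ∷ j ∷ k ∷ []) a) ≤ lookup π (Vec.lookup (i ∷ j ∷ k ∷ []) b))
        ⇔ (lookup (3 ∷ 2 ∷ 1 ∷ []) a ≤ lookup (3 ∷ 2 ∷ 1 ∷ []) b)
    same-order zero             zero             = ≤⇔≤-refl
    same-order zero             (suc zero)       = >>⇒≤⇔≤ y<x (<ᵇ⇒< 2 3 tt)
    same-order zero             (suc (suc zero)) = >>⇒≤⇔≤ (<-trans z<y y<x) (<ᵇ⇒< 1 3 tt)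
    same-order (suc zero)       zero             = <<⇒≤⇔≤ y<x (<ᵇ⇒< 2 3 tt)
    same-order (suc zero)       (suc zero)       = ≤⇔≤-refl
    same-order (suc zero)       (suc (suc zero)) = >>⇒≤⇔≤ z<y (<ᵇ⇒< 1 2 tt)
    same-order (suc (suc zero)) zero             = <<⇒≤⇔≤ (<-trans z<y y<x) (<ᵇ⇒< 1 3 tt)
    same-order (suc (suc zero)) (suc zero)       = <<⇒≤⇔≤ z<y (<ᵇ⇒< 1 2 tt)
    same-order (suc (suc zero)) (suc (suc zero)) = ≤⇔≤-refl

Avoids-213,321 : List ℕ → Set
Avoids-213,321 π = All (Avoids π) ((2 ∷ 1 ∷ 3 ∷ []) ∷ (3 ∷ 2 ∷ 1 ∷ []) ∷ [])

between⇒avoids : ∀ {π} → Triples Between π → Avoids-213,321 π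
between⇒avoids {π} t = avoids-213 ∷ avoids-321 ∷ []
  where
  avoids-213 : Avoids π (2 ∷ 1 ∷ 3 ∷ [])
  avoids-213 (i ∷ j ∷ k ∷ [] , mono , order) =
    <⇒≱ z<x (Equivalence.from (order zero (suc (suc zero))) (≤ᵇ⇒≤ 2 3 tt))
    where
    y<x : lookup π j < lookup π i
    y<x = ≰⇒> λ x≤y → contradiction (Equivalence.to (order zero (suc zero)) x≤y) (<⇒≱ (<ᵇ⇒< 1 2 tt))
    z<x = proj₂ (triples-lookup t (mono zero (suc zero) z<s) (mono (suc zero) (suc (suc zero)) (s≤s z<s)) y<x)

  avoids-321 : Avoids π (3 ∷ 2 ∷ 1 ∷ [])
  avoids-321 (i ∷ j ∷ k ∷ [] , mono , order) =
    <⇒≱ y<z (Equivalence.from (order (suc (suc zero)) (suc zero)) (≤ᵇ⇒≤ 1 2 tt))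
    where
    y<x : lookup π j < lookup π i
    y<x = ≰⇒> λ x≤y → contradiction (Equivalence.to (order zero (suc zero)) x≤y) (<⇒≱ (<ᵇ⇒< 2 3 tt))
    y<z = proj₁ (triples-lookup t (mono zero (suc zero) z<s) (mono (suc zero) (suc (suc zero)) (s≤s z<s)) y<x)

-- Avoidance only refutes `z < y` and `x < z`; distinctness makes the resulting weak inequalities
-- strict.
avoids⇒between : ∀ {π} → Unique π → Avoids-213,321 π → Triples Between π
avoids⇒between {π} !π (¬213 ∷ ¬321 ∷ []) = triples-tabulate π λ i<j j<k y<x →
  ≤∧≢⇒< (≮⇒≥ λ z<y → ¬321 (contains-321 π i<j j<k y<x z<y)) (allPairs-lookup !π j<k) ,
  ≤∧≢⇒< (≮⇒≥ λ x<z → ¬213 (contains-213 π i<j j<k y<x x<z))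
        (≢-sym (allPairs-lookup !π (<-trans i<j j<k)))

-- Ascending labels along a path

module _ {n : ℕ} where

  ascends-E∷ : ∀ {w : List (Step (Fin n))} → Linked Ascends w → Linked Ascends (E ∷ w)
  ascends-E∷ {[]}    _ = [-]
  ascends-E∷ {_ ∷ _} l = tt ∷ l

  increasing⇒ascends : ∀ (w : List (Step (Fin n))) → Increasing (φ w) → Linked Ascends w
  increasing⇒ascends []              _                     = []
  increasing⇒ascends (E ∷ w)         ↗                     = ascends-E∷ (increasing⇒ascends w ↗)
  increasing⇒ascends (N a ∷ [])      _                     = [-]
  increasing⇒ascends (N a ∷ E ∷ w)   (_ ∷ ↗)               = tt ∷ ascends-E∷ (increasing⇒ascends w ↗)
  increasing⇒ascends (N a ∷ N b ∷ w) ((a<b ∷ _) ∷ ↗)       = s≤s⁻¹ a<b ∷ increasing⇒ascends (N b ∷ w) ↗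

  ¬descentAt-0 : ∀ {xs} → ¬ DescentAt 0 xs
  ¬descentAt-0 ()

  -- Labels increase across consecutive north steps, so the upper entry of a descent cannot be
  -- followed by a north step; nor can it end the path, because a smaller label is still to come.
  descent⇒northThenEast : ∀ (w : List (Step (Fin n))) {π m} → φ w ≡ π → DescentAt m π →
    Linked Ascends w → NorthThenEast m w
  descent⇒northThenEast []        refl ()
  descent⇒northThenEast (N a ∷ []) refl ()
  descent⇒northThenEast (E ∷ w) eq d l = east (descent⇒northThenEast w eq d (Linked.tail l))
  descent⇒northThenEast (N a ∷ E ∷ w) eq (here _ _) l = here
  descent⇒northThenEast (N a ∷ E ∷ w) eq (there _ d) (_ ∷ l) =
    north (descent⇒northThenEast (E ∷ w) (∷-injectiveʳ eq) d l)
  descent⇒northThenEast (N a ∷ N b ∷ w) refl (here b<a _) (a<b ∷ _) =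
    contradiction (s≤s⁻¹ b<a) (<-asym a<b)
  descent⇒northThenEast (N a ∷ N b ∷ w) refl (there _ d) (_ ∷ l) =
    north (descent⇒northThenEast (N b ∷ w) refl d l)

  -- The one pair of successive labels that decreases is separated by the given east step; all other
  -- pairs may sit on consecutive north steps.
  northThenEast⇒ascends : ∀ (w : List (Step (Fin n))) {π m} → φ w ≡ π → DescentAt m π →
    NorthThenEast m w → Linked Ascends w
  northThenEast⇒ascends []        refl ()
  northThenEast⇒ascends (N a ∷ []) refl ()
  northThenEast⇒ascends (E ∷ w) eq d (east p) = ascends-E∷ (northThenEast⇒ascends w eq d p)
  northThenEast⇒ascends (N a ∷ E ∷ w) eq (here _ ↗) p =
    tt ∷ ascends-E∷ (increasing⇒ascends w (subst Increasing (sym (∷-injectiveʳ eq)) ↗))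
  northThenEast⇒ascends (N a ∷ E ∷ w) eq (there _ d) here = contradiction d ¬descentAt-0
  northThenEast⇒ascends (N a ∷ E ∷ w) eq (there _ d) (north p) =
    tt ∷ northThenEast⇒ascends (E ∷ w) (∷-injectiveʳ eq) d p
  northThenEast⇒ascends (N a ∷ N b ∷ w) refl (here _ _) (north p) =
    contradiction p (¬northThenEast-zero (N b ∷ w))
  northThenEast⇒ascends (N a ∷ N b ∷ w) refl (there a<b d) (north p) =
    s≤s⁻¹ a<b ∷ northThenEast⇒ascends (N b ∷ w) refl d p

-- Labelled paths as pairs of a permutation and a path

module _ {A : Set} {as : List A} where

  ∈-words : (∀ a → a ∈ as) → ∀ {k} w → length w ≡ k → w ∈ words as k
  ∈-words a∈ []      refl = here refl
  ∈-words a∈ (x ∷ w) refl = ∈-cartesianProductWith⁺ _∷_ (a∈ x) (∈-words a∈ w refl)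

  words-unique : Unique as → ∀ k → Unique (words as k)
  words-unique !as zero    = [] ∷ []
  words-unique !as (suc k) =
    Unique.cartesianProductWith⁺ _∷_ ∷-injective !as (words-unique !as k)

length-cartesianProduct : ∀ {A B : Set} (xs : List A) (ys : List B) →
  length (cartesianProduct xs ys) ≡ length xs * length ys
length-cartesianProduct []       ys = refl
length-cartesianProduct (x ∷ xs) ys = trans (length-++ (map (x ,_) ys))
  (cong₂ _+_ (length-map (x ,_) ys) (length-cartesianProduct xs ys))

length-concat : ∀ {A : Set} (xss : List (List A)) → length (concat xss) ≡ sum (map length xss)
length-concat []         = refl
length-concat (xs ∷ xss) = trans (length-++ xs) (cong (length xs +_) (length-concat xss))

inits-map : ∀ {A B : Set} (f : A → B) xs → inits (map f xs) ≡ map (map f) (inits xs)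
inits-map f []       = refl
inits-map f (x ∷ xs) = cong ([] ∷_) (begin
  map (f x ∷_) (inits (map f xs))        ≡⟨ cong (map (f x ∷_)) (inits-map f xs) ⟩
  map (f x ∷_) (map (map f) (inits xs))  ≡⟨ map-∘ (inits xs) ⟨
  map (map f ∘ (x ∷_)) (inits xs)        ≡⟨ map-∘ (inits xs) ⟩
  map (map f) (map (x ∷_) (inits xs))    ∎)
  where open ≡-Reasoning

module _ {L : Set} where

  forget : Step L → Step ⊤
  forget (N _) = N tt
  forget E     = E

  shape : List (Step L) → List (Step ⊤)
  shape = map forget

  norths-shape : ∀ w → norths (shape w) ≡ norths w
  norths-shape []        = refl
  norths-shape (N _ ∷ w) = cong suc (norths-shape w)
  norths-shape (E ∷ w)   = norths-shape w

  easts-shape : ∀ w → easts (shape w) ≡ easts w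
  easts-shape []        = refl
  easts-shape (N _ ∷ w) = easts-shape w
  easts-shape (E ∷ w)   = cong suc (easts-shape w)

  isDyck-shape⁺ : ∀ {n w} → IsDyck n w → IsDyck n (shape w)
  isDyck-shape⁺ {w = w} (norths≡ , easts≡ , above) =
    trans (norths-shape w) norths≡ , trans (easts-shape w) easts≡ ,
    subst (All _) (sym (inits-map forget w)) (All.map⁺ (All.map
      (λ {u} → subst₂ _≤_ (sym (easts-shape u)) (sym (norths-shape u))) above))

  isDyck-shape⁻ : ∀ {n} w → IsDyck n (shape w) → IsDyck n w
  isDyck-shape⁻ w (norths≡ , easts≡ , above) =
    trans (sym (norths-shape w)) norths≡ , trans (sym (easts-shape w)) easts≡ ,
    All.map (λ {u} → subst₂ _≤_ (easts-shape u) (norths-shape u))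
      (All.map⁻ (subst (All _) (inits-map forget w) above))

  northThenEast-shape⁺ : ∀ {m w} → NorthThenEast m w → NorthThenEast m (shape w)
  northThenEast-shape⁺ here      = here
  northThenEast-shape⁺ (north p) = north (northThenEast-shape⁺ p)
  northThenEast-shape⁺ (east p)  = east (northThenEast-shape⁺ p)

  northThenEast-shape⁻ : ∀ {m} w → NorthThenEast m (shape w) → NorthThenEast m w
  northThenEast-shape⁻ (N _ ∷ E ∷ w) here      = here
  northThenEast-shape⁻ (N _ ∷ w)     (north p) = north (northThenEast-shape⁻ w p)
  northThenEast-shape⁻ (E ∷ w)       (east p)  = east (northThenEast-shape⁻ w p)

  labels-shape-injective : ∀ w w′ → labels w ≡ labels w′ → shape w ≡ shape w′ → w ≡ w′
  labels-shape-injective []        []         _  _  = refl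
  labels-shape-injective (N _ ∷ w) (N _ ∷ w′) l≡ s≡ = cong₂ _∷_
    (cong N (∷-injectiveˡ l≡))
    (labels-shape-injective w w′ (∷-injectiveʳ l≡) (∷-injectiveʳ s≡))
  labels-shape-injective (E ∷ w)   (E ∷ w′)   l≡ s≡ =
    cong (E ∷_) (labels-shape-injective w w′ l≡ (∷-injectiveʳ s≡))

  label : ∀ (π : List L) u → norths u ≡ length π → ∃ λ w → labels w ≡ π × shape w ≡ u
  label []      []        _  = [] , refl , refl
  label (a ∷ π) (N _ ∷ u) eq with label π u (suc-injective eq)
  ... | w , refl , refl = N a ∷ w , refl , refl
  label π       (E ∷ u)   eq with label π u eq
  ... | w , refl , refl = E ∷ w , refl , refl

  length≡norths+easts : ∀ (w : List (Step L)) → length w ≡ norths w + easts w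
  length≡norths+easts []        = refl
  length≡norths+easts (N _ ∷ w) = cong suc (length≡norths+easts w)
  length≡norths+easts (E ∷ w)   =
    trans (cong suc (length≡norths+easts w)) (sym (+-suc (norths w) (easts w)))

  length-isDyck : ∀ {n} {w : List (Step L)} → IsDyck n w → length w ≡ n + n
  length-isDyck {w = w} (norths≡ , easts≡ , _) =
    trans (length≡norths+easts w) (cong₂ _+_ norths≡ easts≡)

paths-unique : ∀ n → Unique (paths n)
paths-unique n = words-unique (((λ ()) ∷ []) ∷ [] ∷ []) (n + n)

∈-paths : ∀ {n u} → IsDyck n u → u ∈ paths n
∈-paths {u = u} dyck =
  ∈-words (λ { (N tt) → here refl ; E → there (here refl) }) u (length-isDyck dyck)

N-injective : ∀ {L : Set} {a b : L} → N a ≡ N b → a ≡ b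
N-injective refl = refl

labelledPaths-unique : ∀ n → Unique (labelledPaths n)
labelledPaths-unique n =
  words-unique (All.map⁺ (All.universal (λ _ ()) _) ∷ Unique.map⁺ N-injective (Unique.allFin⁺ n)) (n + n)

∈-labelledPaths : ∀ {n w} → IsDyck n w → w ∈ labelledPaths n
∈-labelledPaths {w = w} dyck =
  ∈-words (λ { (N a) → there (∈-map⁺ N (∈-allFin a)) ; E → here refl }) w (length-isDyck dyck)

module _ {n : ℕ} where

  suc∘toℕ-injective : ∀ {a b : Fin n} → suc (toℕ a) ≡ suc (toℕ b) → a ≡ b
  suc∘toℕ-injective = Fin.toℕ-injective ∘ suc-injective

  bijective⇒unique : ∀ w → Bijective _≡_ _≡_ (lookup (labels w)) → Unique (φ {n} w)
  bijective⇒unique w (inj , _) = Unique.map⁺ suc∘toℕ-injective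
    (allPairs-tabulate (labels w) (λ i<j eq → Fin.<⇒≢ i<j (inj eq)))

  -- With `bijective⇒unique`, this translates bijectivity of the labelling into the language of the
  -- classification, where the values start at 1.
  bijective⇒spans : ∀ w → Bijective _≡_ _≡_ (lookup (labels w)) → Spans (φ {n} w) 1 (suc n)
  bijective⇒spans w (_ , sur) = to , from
    where
    to : ∀ {v} → v ∈ φ w → 1 ≤ v × v < suc n
    to v∈ with a , _ , refl ← ∈-map⁻ (suc ∘ toℕ) v∈ = s≤s z≤n , s≤s (Fin.toℕ<n a)

    from : ∀ {v} → 1 ≤ v → v < suc n → v ∈ φ w
    from {suc v} _ v<n with i , at-i ← sur (fromℕ< (s≤s⁻¹ v<n)) =
      subst (_∈ φ w) (cong suc (trans (cong toℕ (at-i refl)) (Fin.toℕ-fromℕ< (s≤s⁻¹ v<n))))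
        (∈-map⁺ (suc ∘ toℕ) (∈-lookup i))

  unique∧spans⇒bijective : ∀ w → Unique (φ {n} w) → Spans (φ w) 1 (suc n) →
    Bijective _≡_ _≡_ (lookup (labels w))
  unique∧spans⇒bijective w !w (_ , from) = lookup-injective (Unique.map⁻ !w) , surjective
    where
    surjective : Surjective _≡_ _≡_ (lookup (labels w))
    surjective y with a , a∈ , eq ← ∈-map⁻ (suc ∘ toℕ) (from {suc (toℕ y)} (s≤s z≤n) (s≤s (Fin.toℕ<n y)))
                 with refl ← suc∘toℕ-injective eq =
      Any.index a∈ , λ { refl → sym (Any.lookup-index a∈) }

  ∈[1,n]⇒φ-image : ∀ {π} → All (λ v → 1 ≤ v × v < suc n) π → ∃ λ (as : List (Fin n)) → map (suc ∘ toℕ) as ≡ π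
  ∈[1,n]⇒φ-image []                               = [] , refl
  ∈[1,n]⇒φ-image {suc v ∷ π} ((_ , v<) ∷ bounds) with as , refl ← ∈[1,n]⇒φ-image bounds =
    fromℕ< (s≤s⁻¹ v<) ∷ as , cong₂ _∷_ (cong suc (Fin.toℕ-fromℕ< (s≤s⁻¹ v<))) refl

-- Taking `φ w` and not `labels w` puts the permutation in ℕ, where `range` and `block` enumerate
-- the candidates.
decompose : ∀ {n} → List (Step (Fin n)) → List ℕ × List (Step ⊤)
decompose w = φ w , shape w

decompose-injective : ∀ {n} {w w′ : List (Step (Fin n))} → decompose w ≡ decompose w′ → w ≡ w′
decompose-injective {w = w} {w′} eq = labels-shape-injective w w′
  (map-injective suc∘toℕ-injective (,-injectiveˡ eq)) (,-injectiveʳ eq)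

IsGood : ∀ n → List (Step (Fin n)) → Set
IsGood n w = IsParkingFunction n w × Avoids-213,321 (φ w)

isGood? : ∀ n → Decidable (IsGood n)
isGood? n w =
  isParkingFunction? n w ×-dec All.all? (avoids? (φ w)) ((2 ∷ 1 ∷ 3 ∷ []) ∷ (3 ∷ 2 ∷ 1 ∷ []) ∷ [])

goodPaths : ∀ n → List (List (Step (Fin n)))
goodPaths n = filter (isGood? n) (labelledPaths n)

-- The explicit list of pairs

isDyckNorthThenEast? : ∀ n m → Decidable (λ (u : List (Step ⊤)) → IsDyck n u × NorthThenEast m u)
isDyckNorthThenEast? n m u = isDyck? n u ×-dec northThenEast? m u

northThenEastPaths : ℕ → ℕ → List (List (Step ⊤))
northThenEastPaths n m = filter (isDyckNorthThenEast? n m) (paths n)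

-- The descent comes after the `i` fixed entries and the whole upper interval, which leaves `m ∸ i`
-- entries for the latter. The length `m` of this list is the weight in the sum.
blocks : ℕ → ℕ → List (List ℕ)
blocks n m = applyUpTo (λ i → block 1 i (m ∸ i) (n ∸ m)) m

withDescentAt : ℕ → ℕ → List (List ℕ × List (Step ⊤))
withDescentAt n m = cartesianProduct (blocks n m) (northThenEastPaths n m)

withoutDescent : ℕ → List (List ℕ × List (Step ⊤))
withoutDescent n = map (range 1 n ,_) (dyckPaths n)

pairs : ℕ → List (List ℕ × List (Step ⊤))
pairs n = withoutDescent n ++ concat (map (withDescentAt n) (applyUpTo suc (n ∸ 1)))

length-pairs : ∀ n → length (pairs n) ≡ catalan n + (∑[1≤m≤ n ∸ 1 ] (λ m → m * h n m))
length-pairs n = begin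
  length (pairs n)
    ≡⟨ length-++ (withoutDescent n) ⟩
  length (withoutDescent n) + length (concat (map (withDescentAt n) ms))
    ≡⟨ cong₂ _+_ (trans (length-map _ (dyckPaths n)) (length-dyckPaths n))
                 (length-concat (map (withDescentAt n) ms)) ⟩
  catalan n + sum (map length (map (withDescentAt n) ms))
    ≡⟨ cong (λ x → catalan n + sum x) (trans (sym (map-∘ ms)) (map-cong length-withDescentAt ms)) ⟩
  catalan n + (∑[1≤m≤ n ∸ 1 ] (λ m → m * h n m)) ∎
  where
  open ≡-Reasoning
  ms = applyUpTo suc (n ∸ 1)
  length-withDescentAt : ∀ m → length (withDescentAt n m) ≡ m * h n m
  length-withDescentAt m = trans (length-cartesianProduct (blocks n m) (northThenEastPaths n m))
    (cong (_* h n m) (length-applyUpTo _ m))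

∈-blocks⁺ : ∀ i t b → block 1 i (suc t) (suc b) ∈ blocks (i + (suc t + suc b)) (suc (i + t))
∈-blocks⁺ i t b = subst₂ (λ t′ b′ → block 1 i t′ b′ ∈ blocks n m) m∸i n∸m
  (∈-applyUpTo⁺ (λ i → block 1 i (m ∸ i) (n ∸ m)) (s≤s (m≤m+n i t)))
  where
  n m : ℕ
  n = i + (suc t + suc b)
  m = suc (i + t)
  m∸i : m ∸ i ≡ suc t
  m∸i = trans (cong (_∸ i) (sym (+-suc i t))) (m+n∸m≡n i (suc t))
  n∸m : n ∸ m ≡ suc b
  n∸m = begin
    n ∸ m                       ≡⟨ cong₂ _∸_ (sym (+-assoc i (suc t) (suc b))) (sym (+-suc i t)) ⟩
    i + suc t + suc b ∸ (i + suc t) ≡⟨ m+n∸m≡n (i + suc t) (suc b) ⟩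
    suc b                       ∎
    where open ≡-Reasoning

-- The inequalities `i < m` and `m < n` make both truncated differences positive, so the swapped
-- intervals are nonempty.
∈-blocks⁻ : ∀ {π n m} → m < n → π ∈ blocks n m →
  ∃ λ i → ∃₂ λ t b → i + suc t ≡ m × i + (suc t + suc b) ≡ n × π ≡ block 1 i (suc t) (suc b)
∈-blocks⁻ {n = n} {m} m<n π∈
  with i , i<m , refl ← ∈-applyUpTo⁻ (λ i → block 1 i (m ∸ i) (n ∸ m)) π∈
  with t , refl ← <⇒∃+suc i<m
  with b , refl ← <⇒∃+suc m<n =
  i , t , b , refl , sym (+-assoc i (suc t) (suc b)) ,
  cong₂ (block 1 i) (m+n∸m≡n i (suc t)) (m+n∸m≡n (i + suc t) (suc b))

descentAt-blocks : ∀ {π n m} → m < n → π ∈ blocks n m → DescentAt m π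
descentAt-blocks m<n π∈ with i , t , b , refl , _ , refl ← ∈-blocks⁻ m<n π∈ = descentAt-block 1 i t b

blocks-unique : ∀ {n m} → m < n → Unique (blocks n m)
blocks-unique {n} {m} m<n = Unique.applyUpTo⁺₁ _ m distinct
  where
  distinct : ∀ {i j} → i < j → j < m → block 1 i (m ∸ i) (n ∸ m) ≢ block 1 j (m ∸ j) (n ∸ m)
  distinct {i} {j} i<j j<m eq
    -- Applied to `0 < m ∸ i` and its analogues, `<⇒∃+suc` exhibits each size as a successor, as
    -- `block-injective` requires.
    with t  , p ← <⇒∃+suc (m<n⇒0<n∸m (<-trans i<j j<m))
       | t′ , q ← <⇒∃+suc (m<n⇒0<n∸m j<m)
       | b  , r ← <⇒∃+suc (m<n⇒0<n∸m m<n)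
    rewrite p | q | r = <⇒≢ i<j (block-injective 1 i j t t′ b b eq)

<n∸1⇒suc<n : ∀ {n j} → j < n ∸ 1 → suc j < n
<n∸1⇒suc<n {suc n} j<n = s≤s j<n

∈-withoutDescent⁻ : ∀ {n π u} → (π , u) ∈ withoutDescent n → π ≡ range 1 n × IsDyck n u
∈-withoutDescent⁻ {n} p∈ =
  let _ , u∈ , eq = ∈-map⁻ (range 1 n ,_) p∈
  in ,-injectiveˡ eq ,
     subst (IsDyck n) (sym (,-injectiveʳ eq)) (proj₂ (∈-filter⁻ (isDyck? n) {xs = paths n} u∈))

∈-withDescentAt⁻ : ∀ {n m π u} → (π , u) ∈ withDescentAt n m →
  π ∈ blocks n m × IsDyck n u × NorthThenEast m u
∈-withDescentAt⁻ {n} {m} p∈ =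
  let π∈ , u∈ = ∈-cartesianProduct⁻ (blocks n m) (northThenEastPaths n m) p∈
  in π∈ , proj₂ (∈-filter⁻ (isDyckNorthThenEast? n m) {xs = paths n} u∈)

∈-descents⁻ : ∀ {n p} → p ∈ concat (map (withDescentAt n) (applyUpTo suc (n ∸ 1))) →
  ∃ λ m → m < n × p ∈ withDescentAt n m
∈-descents⁻ {n} {p} p∈ =
  let _ , p∈m , m∈ = ∈-concat⁻′ (map (withDescentAt n) (applyUpTo suc (n ∸ 1))) p∈
      m , m∈ms , eq = ∈-map⁻ (withDescentAt n) m∈
      j , j< , m≡ = ∈-applyUpTo⁻ suc m∈ms
  in m , subst (_< n) (sym m≡) (<n∸1⇒suc<n j<) , subst (p ∈_) eq p∈m

-- The permutation alone separates the pieces: a range is never a block, and blocks from different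
-- `m` have their descents at different positions.
pairs-unique : ∀ n → Unique (pairs n)
pairs-unique n = Unique.++⁺
  (Unique.map⁺ ,-injectiveʳ (Unique.filter⁺ (isDyck? n) (paths-unique n)))
  (Unique.concat⁺ (All.map⁺ (All.applyUpTo⁺₁ suc (n ∸ 1) unique))
                  (AllPairs.map⁺ (AllPairs.applyUpTo⁺₁ suc (n ∸ 1) disjoint)))
  range≢blocks
  where
  unique : ∀ {j} → j < n ∸ 1 → Unique (withDescentAt n (suc j))
  unique {j} j< = Unique.cartesianProduct⁺ (blocks-unique {n} {suc j} (<n∸1⇒suc<n j<))
    (Unique.filter⁺ (isDyckNorthThenEast? n (suc j)) (paths-unique n))

  disjoint : ∀ {j k} → j < k → k < n ∸ 1 → Disjoint (withDescentAt n (suc j)) (withDescentAt n (suc k))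
  disjoint {j} {k} j<k k< (p∈ , q∈) = <⇒≢ (s≤s j<k) (descentAt-injective
    (descentAt-blocks {n = n} (<n∸1⇒suc<n (<-trans j<k k<)) (proj₁ (∈-withDescentAt⁻ {n} p∈)))
    (descentAt-blocks {n = n} (<n∸1⇒suc<n k<) (proj₁ (∈-withDescentAt⁻ {n} q∈))))

  range≢blocks : Disjoint (withoutDescent n) (concat (map (withDescentAt n) (applyUpTo suc (n ∸ 1))))
  range≢blocks (p∈ , q∈) =
    let π≡ , _ = ∈-withoutDescent⁻ {n} p∈
        m , m<n , q∈m = ∈-descents⁻ {n} q∈
        i , t , b , _ , _ , eq = ∈-blocks⁻ m<n (proj₁ (∈-withDescentAt⁻ {n} {m} q∈m))
    in range≢block 1 n i t b (trans (sym π≡) eq)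

-- Matching good labelled paths with pairs

goodPath⇒∈-pairs : ∀ {n w} → IsGood n w → decompose w ∈ pairs n
goodPath⇒∈-pairs {n} {w} ((dyck , bij , ascends) , avoids) =
  [ sorted , swapped ] (range-or-block 1 n (φ w) (bijective⇒unique w bij)
    (avoids⇒between (bijective⇒unique w bij) avoids) (bijective⇒spans w bij))
  where
  dyck′ : IsDyck n (shape w)
  dyck′ = isDyck-shape⁺ dyck

  sorted : φ w ≡ range 1 n → decompose w ∈ pairs n
  sorted eq = ∈-++⁺ˡ (subst (λ π → (π , shape w) ∈ withoutDescent n) (sym eq)
    (∈-map⁺ (range 1 n ,_) (∈-filter⁺ (isDyck? n) (∈-paths dyck′) dyck′)))

  swapped : IsBlock (φ w) 1 n → decompose w ∈ pairs n
  swapped (i , t , b , n≡ , eq) = ∈-++⁺ʳ (withoutDescent n)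
    (∈-concat⁺′
      (∈-cartesianProduct⁺ φw∈
        (∈-filter⁺ (isDyckNorthThenEast? n m) (∈-paths dyck′) (dyck′ , nte)))
      (∈-map⁺ (withDescentAt n) (∈-applyUpTo⁺ suc i+t<n∸1)))
    where
    m = suc (i + t)

    φw∈ : φ w ∈ blocks n m
    φw∈ = subst₂ (λ π n → π ∈ blocks n m) (sym eq) n≡ (∈-blocks⁺ i t b)

    nte : NorthThenEast m (shape w)
    nte = northThenEast-shape⁺ (descent⇒northThenEast w eq
      (subst (λ m → DescentAt m (block 1 i (suc t) (suc b))) (+-suc i t) (descentAt-block 1 i t b)) ascends)

    i+t<n∸1 : i + t < n ∸ 1
    -- Once `n` is written as `suc (i + (t + suc b))`, the truncated difference computes; strictness
    -- comes from the nonempty lower interval.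
    i+t<n∸1 = subst (λ n → i + t < n ∸ 1) (trans (sym (+-suc i (t + suc b))) n≡)
      (+-monoʳ-< i (m<m+n t z<s))

length-range : ∀ a k → length (range a k) ≡ k
length-range a zero    = refl
length-range a (suc k) = cong suc (length-range (suc a) k)

length-block : ∀ a i t b → length (block a i t b) ≡ i + (t + b)
length-block a zero    t b = trans (length-++ (range (a + b) t))
  (cong₂ _+_ (length-range (a + b) t) (length-range a b))
length-block a (suc i) t b = cong suc (length-block (suc a) i t b)

-- Common to both kinds of pairs. The labelled path is built only inside, so the ascent condition,
-- the one point where the kinds differ in their use of `u`, is asked of every `w` with the given
-- permutation and shape.
goodPath : ∀ {n π u} → length π ≡ n → Unique π → Spans π 1 (suc n) → Triples Between π →
  IsDyck n u → (∀ (w : List (Step (Fin n))) → φ w ≡ π → shape w ≡ u → Linked Ascends w) →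
  ∃ λ w → IsGood n w × (π , u) ≡ decompose w
goodPath {n} {u = u} length≡ !π spans between dyck ascends
  with as , refl ← ∈[1,n]⇒φ-image (All.tabulate (proj₁ spans))
  with w , refl , refl ← label as u (trans (proj₁ dyck) (trans (sym length≡) (length-map _ as))) =
  w ,
  ((isDyck-shape⁻ w dyck , unique∧spans⇒bijective w !π spans , ascends w refl refl) ,
   between⇒avoids between) ,
  refl

∈-pairs⇒goodPath : ∀ {n π u} → (π , u) ∈ pairs n → ∃ λ w → IsGood n w × (π , u) ≡ decompose w
∈-pairs⇒goodPath {n} {π} {u} p∈ = [ sorted , swapped ] (∈-++⁻ (withoutDescent n) p∈)
  where
  Goal : Set
  Goal = ∃ λ w → IsGood n w × (π , u) ≡ decompose w

  sorted : (π , u) ∈ withoutDescent n → Goal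
  sorted p∈ = from-range (∈-withoutDescent⁻ p∈)
    where
    from-range : π ≡ range 1 n × IsDyck n u → Goal
    from-range (refl , dyck) =
      goodPath (length-range 1 n) (increasing⇒unique range↗) (range-spans 1 n)
        (increasing-between range↗) dyck
        λ w φ≡ _ → increasing⇒ascends w (subst Increasing (sym φ≡) range↗)
      where range↗ = range-increasing 1 n

  swapped : (π , u) ∈ concat (map (withDescentAt n) (applyUpTo suc (n ∸ 1))) → Goal
  swapped p∈ =
    let m , m<n , p∈m = ∈-descents⁻ {n} p∈
        π∈ , dyck , nte = ∈-withDescentAt⁻ {n} {m} p∈m
    in from-block (∈-blocks⁻ m<n π∈) dyck nte
    where
    from-block : ∀ {m} →
      (∃ λ i → ∃₂ λ t b → i + suc t ≡ m × i + (suc t + suc b) ≡ n × π ≡ block 1 i (suc t) (suc b)) →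
      IsDyck n u → NorthThenEast m u → Goal
    from-block (i , t , b , refl , refl , refl) dyck nte =
      goodPath (length-block 1 i (suc t) (suc b)) (block-unique 1 i (suc t) (suc b))
        (block-spans 1 i (suc t) (suc b)) (block-between 1 i (suc t) (suc b)) dyck
        λ { w φ≡ refl → northThenEast⇒ascends w φ≡ (descentAt-block 1 i t b) (northThenEast-shape⁻ w nte) }

theorem25 : (n : ℕ) → n ≥ 1 →
    pf n ((2 ∷ 1 ∷ 3 ∷ []) ∷ (3 ∷ 2 ∷ 1 ∷ []) ∷ []) ≡ catalan n + (∑[1≤m≤ n ∸ 1 ] (λ m → m * h n m))
theorem25 n _ = begin
  length (goodPaths n)                  ≡⟨ length-map decompose (goodPaths n) ⟨
  -- Duplicate-free lists with the same members agree as bags and hence are permutations of each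
  -- other.
  length (map decompose (goodPaths n))  ≡⟨ ↭-length (∼bag⇒↭ (unique∧set⇒bag unique (pairs-unique n) (mk⇔ to from))) ⟩
  length (pairs n)                      ≡⟨ length-pairs n ⟩
  catalan n + (∑[1≤m≤ n ∸ 1 ] (λ m → m * h n m)) ∎
  where
  open ≡-Reasoning
  unique : Unique (map decompose (goodPaths n))
  unique = Unique.map⁺ decompose-injective (Unique.filter⁺ (isGood? n) (labelledPaths-unique n))

  to : ∀ {p} → p ∈ map decompose (goodPaths n) → p ∈ pairs n
  to p∈ =
    let w , w∈ , p≡ = ∈-map⁻ decompose p∈
    in subst (_∈ pairs n) (sym p≡)
         (goodPath⇒∈-pairs (proj₂ (∈-filter⁻ (isGood? n) {xs = labelledPaths n} w∈)))

  from : ∀ {p} → p ∈ pairs n → p ∈ map decompose (goodPaths n)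
  from p∈ =
    let w , good , p≡ = ∈-pairs⇒goodPath {n} p∈
    in subst (_∈ map decompose (goodPaths n)) (sym p≡)
         (∈-map⁺ decompose (∈-filter⁺ (isGood? n) (∈-labelledPaths (proj₁ (proj₁ good))) good))
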